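{- Let $G$ be a graph with $n$ vertices, $m$ edges, maximum degree $\triangle$ and minimum degree $\delta\ge 2$. Then $$HM_1(G)\le\frac{(\triangle+\delta)^2}{4m\triangle\delta}M_1(G)^2.$$ Equality holds if and only if $G$ is a regular graph, or there are exactly $\frac{m\delta}{\triangle+\delta}$ edges $e$ of edge degree $d(e)=2\triangle$ and exactly $\frac{m\triangle}{\triangle+\delta}$ edges $e$ of edge degree $d(e)=2\delta$, where $\triangle+\delta$ divides $m\delta$.
   Context: Graphs are finite (with nonempty vertex set), without loops or multiple edges. For a vertex $u$, $d(u)$ is its degree; $\triangle$ and $\delta$ are the maximum and minimum vertex degree of $G$. For an edge $e=uv$ the edge degree is $d(e)=d(u)+d(v)$. The first Zagreb index is $M_1(G)=\sum_{v\in V(G)}d(v)^2$. The first hyper-Zagreb index is $HM_1(G)=\sum_{e\in E(G)}d(e)^2$. A graph is regular if all its vertices have the same degree. -}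

module Defs where

open import Data.Fin using (Fin; _<_)
open import Data.Fin.Properties using (_<?_; <-cmp)
open import Data.List using (List; length; filter; map; allFin; cartesianProduct; []; _∷_)
open import Data.List.Extrema.Nat using (max; min; min≤⊤; min≤xs)
open import Data.List.Membership.Propositional using (_∈_)
open import Data.List.Membership.Propositional.Properties
  using (∈-filter⁺; ∈-filter⁻; ∈-cartesianProduct⁺; ∈-allFin; ∈-map⁺)
open import Data.List.Relation.Unary.All using (lookup)
open import Data.List.Relation.Unary.Any using (here)
open import Data.Nat as ℕ using (ℕ; zero; suc; _+_; _^_; _≤_; NonZero; s≤s; z≤n)
open import Data.Nat.ListAction using (sum)
import Data.Nat.Properties as ℕ
open import Data.Product using (_×_; _,_; ∃; proj₂)
open import Level using (0ℓ)
open import Relation.Binary using (Rel; Decidable; Symmetric; Irreflexive; tri<; tri≈; tri>)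
open import Relation.Binary.PropositionalEquality using (_≡_; refl)
open import Relation.Nullary.Decidable using (_×-dec_)

record Graph (n : ℕ) : Set₁ where
  field
    ⦃ nonEmpty ⦄ : NonZero n
    Adj    : Rel (Fin n) 0ℓ
    adj?   : Decidable Adj
    symm   : Symmetric Adj
    irrefl : Irreflexive _≡_ Adj

  degree : Fin n → ℕ
  degree u = length (filter (adj? u) (allFin n))

  degrees : List ℕ
  degrees = map degree (allFin n)

  Δ : ℕ
  Δ = max 0 degrees

  -- The first argument of `min` is a default that takes part in the minimum;
  -- as there is at least one vertex, Δ leaves the minimum unchanged.
  δ : ℕ
  δ = min Δ degrees

  -- An edge uv is represented by the pair (u , v) with u < v, so that each
  -- edge is listed exactly once.
  edges : List (Fin n × Fin n)
  edges = filter (λ (u , v) → (u <? v) ×-dec adj? u v) (cartesianProduct (allFin n) (allFin n))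

  m : ℕ
  m = length edges

  edgeDegree : Fin n × Fin n → ℕ
  edgeDegree (u , v) = degree u + degree v

  edgesOfDegree : ℕ → ℕ
  edgesOfDegree k = length (filter (λ e → edgeDegree e ℕ.≟ k) edges)

  M₁ : ℕ
  M₁ = sum (map (λ v → degree v ^ 2) (allFin n))

  HM₁ : ℕ
  HM₁ = sum (map (λ e → edgeDegree e ^ 2) edges)

  Regular : Set
  Regular = ∀ u v → degree u ≡ degree v

  δ≢0 : 2 ≤ δ → NonZero δ
  δ≢0 2≤δ = ℕ.>-nonZero (ℕ.<-trans (s≤s z≤n) 2≤δ)

  Δ≢0 : 2 ≤ δ → NonZero Δ
  Δ≢0 2≤δ = ℕ.>-nonZero (ℕ.≤-trans (s≤s z≤n) (ℕ.≤-trans 2≤δ (min≤⊤ Δ degrees)))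

  private
    vertex : ∀ k → .⦃ NonZero k ⦄ → Fin k
    vertex (suc k) = Fin.zero

    inhabited : ∀ {A : Set} (xs : List A) → 1 ≤ length xs → ∃ (_∈ xs)
    inhabited (x ∷ _) _ = x , here refl

    nonZero-length : ∀ {A : Set} {x : A} {xs : List A} → x ∈ xs → NonZero (length xs)
    nonZero-length {xs = _ ∷ _} _ = _

    adj⇒m≢0 : ∀ u v → Adj u v → NonZero m
    adj⇒m≢0 u v uv with <-cmp u v
    ... | tri< u<v _ _ = nonZero-length
          (∈-filter⁺ _ (∈-cartesianProduct⁺ (∈-allFin u) (∈-allFin v)) (u<v , uv))
    ... | tri> _ _ v<u = nonZero-length
          (∈-filter⁺ _ (∈-cartesianProduct⁺ (∈-allFin v) (∈-allFin u)) (v<u , symm uv))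
    ... | tri≈ _ u≡v _ with () ← irrefl u≡v uv

  m≢0 : 2 ≤ δ → NonZero m
  m≢0 2≤δ =
    let u = vertex n
        δ≤d = lookup (min≤xs Δ degrees) (∈-map⁺ degree (∈-allFin u))
        v , v∈ = inhabited (filter (adj? u) (allFin n))
                   (ℕ.≤-trans (s≤s z≤n) (ℕ.≤-trans 2≤δ δ≤d))
    in adj⇒m≢0 u v (proj₂ (∈-filter⁻ (adj? u) {xs = allFin n} v∈))

  4mΔδ≢0 : 2 ≤ δ → NonZero (4 ℕ.* m ℕ.* Δ ℕ.* δ)
  4mΔδ≢0 2≤δ = ℕ.m*n≢0 (4 ℕ.* m ℕ.* Δ) δ
    where instance
      _ = δ≢0 2≤δ
      _ = Δ≢0 2≤δ
      _ = m≢0 2≤δ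
      _ = ℕ.m*n≢0 4 m
      _ = ℕ.m*n≢0 (4 ℕ.* m) Δ

  Δ+δ≢0 : 2 ≤ δ → NonZero (Δ + δ)
  Δ+δ≢0 2≤δ = ℕ.>-nonZero (ℕ.≤-trans (s≤s z≤n) (ℕ.≤-trans 2≤δ (ℕ.m≤n+m δ Δ)))

module Submission where

-- Every edge degree x lies in [p , q] = [2δ , 2Δ], so x² + p q + (x − p)(q − x) = (p + q) x.
-- Summing over the edges, where Σ d(e) = M₁ by double counting, gives
-- HM₁ + p q m + D = (p + q) M₁ with D ≥ 0, and AM-GM applied to HM₁ and p q m is the bound.
-- Equality holds iff D = 0, so that only the edge degrees p and q occur, and HM₁ = p q m,
-- which for p < q fixes the number of edges of each kind.

open import Defs
open import Data.Bool using (true; false; if_then_else_)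
import Data.Fin as Fin
import Data.Fin.Properties as Fin
open import Data.Integer using (+_)
import Data.Integer as ℤ
import Data.Integer.Properties as ℤ
open import Data.List using (List; []; _∷_; _++_; map; filter; length; allFin; cartesianProduct)
open import Data.List.Extrema.Nat using (max≤v⁺; v≤min⁺; min≤⊤; min≤xs; xs≤max)
open import Data.List.Membership.Propositional.Properties using (∈-allFin; ∈-map⁺)
open import Data.List.Properties using (map-cong; map-cong-local; map-++; map-∘)
open import Data.List.Relation.Unary.All as All using (All; []; _∷_)
import Data.List.Relation.Unary.All.Properties as All
open import Data.Nat as ℕ using (ℕ; suc; NonZero; _+_; _*_; _∸_; _^_; z≤n; s≤s)
open import Data.Nat.Divisibility using (_∣_; divides; n∣m*n; ∣m+n∣m⇒∣n)
open import Data.Nat.DivMod using (m/n*n≡m; m*n/n≡m)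
open import Data.Nat.ListAction using (sum)
open import Data.Nat.ListAction.Properties using (sum-++)
open import Data.Nat.Properties
open import Data.Nat.Tactic.RingSolver using (solve-∀)
open import Data.Product using (_×_; _,_; proj₁; proj₂)
open import Data.Rational as ℚ using (toℚᵘ)
import Data.Rational.Properties as ℚ
open import Data.Rational.Unnormalised as ℚᵘ using (mkℚᵘ; *≡*; *≤*)
import Data.Rational.Unnormalised.Properties as ℚᵘ
open import Data.Sum using (_⊎_; inj₁; inj₂)
open import Data.Sum.Function.Propositional using (_⊎-⇔_)
open import Function using (_∘_)
open import Function.Bundles using (_⇔_; mk⇔; Equivalence)
open import Function.Construct.Composition using (_⇔-∘_)
open import Function.Construct.Identity using (⇔-id)
open import Relation.Binary.Definitions using (tri<; tri≈; tri>)
open import Relation.Binary.PropositionalEquality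
open import Relation.Nullary using (Dec; yes; no; does; ¬_; contradiction)
open import Relation.Nullary.Decidable using (_×-dec_)
open import Relation.Unary using (Pred; Decidable)

-- Finite sums over lists and indicator functions.

private variable
  A B : Set

∑ : List A → (A → ℕ) → ℕ
∑ xs f = sum (map f xs)

syntax ∑ xs (λ x → e) = ∑[ x ∈ xs ] e

-- Through indicators, sums over filtered lists and lengths of filtered lists become sums over the
-- full list, where they can be split, swapped and compared term by term.
𝟙 : {P : Set} → Dec P → ℕ
𝟙 P? = if does P? then 1 else 0

𝟙-yes : {P : Set} (P? : Dec P) → P → 𝟙 P? ≡ 1
𝟙-yes (yes _) p = refl
𝟙-yes (no ¬p) p = contradiction p ¬p

𝟙-no : {P : Set} (P? : Dec P) → ¬ P → 𝟙 P? ≡ 0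
𝟙-no (yes p) ¬p = contradiction p ¬p
𝟙-no (no _)  ¬p = refl

𝟙-cong : {P Q : Set} (P? : Dec P) (Q? : Dec Q) → (P → Q) → (Q → P) → 𝟙 P? ≡ 𝟙 Q?
𝟙-cong (yes p) Q? P→Q Q→P = sym (𝟙-yes Q? (P→Q p))
𝟙-cong (no ¬p) Q? P→Q Q→P = sym (𝟙-no Q? (¬p ∘ Q→P))

∑-cong : (xs : List A) {f g : A → ℕ} → (∀ x → f x ≡ g x) → ∑ xs f ≡ ∑ xs g
∑-cong xs f≗g = cong sum (map-cong f≗g xs)

∑-cong-local : (xs : List A) {f g : A → ℕ} → All (λ x → f x ≡ g x) xs → ∑ xs f ≡ ∑ xs g
∑-cong-local xs f≡g = cong sum (map-cong-local f≡g)

∑-+ : (xs : List A) (f g : A → ℕ) → ∑[ x ∈ xs ] (f x + g x) ≡ ∑ xs f + ∑ xs g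
∑-+ []       f g = refl
∑-+ (x ∷ xs) f g = trans (cong (_+_ (f x + g x)) (∑-+ xs f g)) (eq (f x) (g x) (∑ xs f) (∑ xs g))
  where
    eq : ∀ a b c d → a + b + (c + d) ≡ a + c + (b + d)
    eq = solve-∀

∑-*ˡ : (xs : List A) (c : ℕ) (f : A → ℕ) → ∑[ x ∈ xs ] (c * f x) ≡ c * ∑ xs f
∑-*ˡ []       c f = sym (*-zeroʳ c)
∑-*ˡ (x ∷ xs) c f = trans (cong (_+_ (c * f x)) (∑-*ˡ xs c f)) (sym (*-distribˡ-+ c (f x) (∑ xs f)))

∑-const : (xs : List A) (c : ℕ) → ∑[ _ ∈ xs ] c ≡ c * length xs
∑-const []       c = sym (*-zeroʳ c)
∑-const (x ∷ xs) c = trans (cong (_+_ c) (∑-const xs c)) (sym (*-suc c (length xs)))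

∑-swap : (xs : List A) (ys : List B) (f : A → B → ℕ) →
         ∑[ x ∈ xs ] (∑[ y ∈ ys ] f x y) ≡ ∑[ y ∈ ys ] (∑[ x ∈ xs ] f x y)
∑-swap []       ys f = sym (∑-const ys 0)
∑-swap (x ∷ xs) ys f = trans (cong (_+_ (∑ ys (f x))) (∑-swap xs ys f))
                             (sym (∑-+ ys (f x) (λ y → ∑[ x ∈ xs ] f x y)))

∑-cartesianProduct : (xs : List A) (ys : List B) (f : A × B → ℕ) →
                     ∑ (cartesianProduct xs ys) f ≡ ∑[ x ∈ xs ] (∑[ y ∈ ys ] f (x , y))
∑-cartesianProduct []       ys f = refl
∑-cartesianProduct (x ∷ xs) ys f = begin
  sum (map f (map (x ,_) ys ++ cartesianProduct xs ys))
    ≡⟨ cong sum (map-++ f (map (x ,_) ys) _) ⟩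
  sum (map f (map (x ,_) ys) ++ map f (cartesianProduct xs ys))
    ≡⟨ sum-++ (map f (map (x ,_) ys)) _ ⟩
  ∑ (map (x ,_) ys) f + ∑ (cartesianProduct xs ys) f
    ≡⟨ cong₂ _+_ (cong sum (sym (map-∘ ys))) (∑-cartesianProduct xs ys f) ⟩
  ∑[ y ∈ ys ] f (x , y) + ∑[ x ∈ xs ] (∑[ y ∈ ys ] f (x , y)) ∎
  where open ≡-Reasoning

∑-filter : {P : Pred A _} (P? : Decidable P) (xs : List A) (f : A → ℕ) →
           ∑ (filter P? xs) f ≡ ∑[ x ∈ xs ] (𝟙 (P? x) * f x)
∑-filter P? []       f = refl
∑-filter P? (x ∷ xs) f with does (P? x)
... | true  = cong₂ _+_ (sym (*-identityˡ (f x))) (∑-filter P? xs f)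
... | false = ∑-filter P? xs f

length-filter-∑ : {P : Pred A _} (P? : Decidable P) (xs : List A) →
                  length (filter P? xs) ≡ ∑[ x ∈ xs ] 𝟙 (P? x)
length-filter-∑ P? []       = refl
length-filter-∑ P? (x ∷ xs) with does (P? x)
... | true  = cong suc (length-filter-∑ P? xs)
... | false = length-filter-∑ P? xs

∑-mono-≤ : (xs : List A) {f g : A → ℕ} → (∀ x → f x ℕ.≤ g x) → ∑ xs f ℕ.≤ ∑ xs g
∑-mono-≤ []       f≤g = z≤n
∑-mono-≤ (x ∷ xs) f≤g = +-mono-≤ (f≤g x) (∑-mono-≤ xs f≤g)

+-tight : ∀ {a b c d} → a ℕ.≤ b → c ℕ.≤ d → a + c ≡ b + d → a ≡ b × c ≡ d
+-tight {a} {b} {c} {d} a≤b c≤d eq = a≡b , +-cancelˡ-≡ b c d (trans (cong (_+ c) (sym a≡b)) eq)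
  where
    a≡b = ≤∧≮⇒≡ a≤b λ a<b → <-irrefl eq (+-mono-<-≤ a<b c≤d)

-- One strict term would make the whole sum strict. This serves twice: a vanishing defect `D`
-- vanishes termwise, and two counts that exhaust the list leave no other values.
∑-tight : (xs : List A) {f g : A → ℕ} → (∀ x → f x ℕ.≤ g x) → ∑ xs f ≡ ∑ xs g →
          All (λ x → f x ≡ g x) xs
∑-tight []       f≤g eq = []
∑-tight (x ∷ xs) f≤g eq with +-tight (f≤g x) (∑-mono-≤ xs f≤g) eq
... | fx≡gx , rest = fx≡gx ∷ ∑-tight xs f≤g rest

-- AM-GM with a slack term, and the algebra of two-valued lists.

2*-+ : ∀ a → 2 * a ≡ a + a
2*-+ a = cong (_+_ a) (+-identityʳ a)

^2-* : ∀ a → a ^ 2 ≡ a * a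
^2-* a = cong (a *_) (*-identityʳ a)

-- With `b = a + k` this is the subtraction-free form of (a + b + d)² - 4ab = (b - a)² + d(2(a + b)
-- + d), whose right side is visibly nonnegative.
am-gm-excess : ∀ a k d → (a + (a + k) + d) * (a + (a + k) + d) ≡
                 4 * (a * (a + k)) + (k * k + d * (a + (a + k) + (a + (a + k)) + d))
am-gm-excess = solve-∀

am-gm-≤ : ∀ a k d → let b = a + k in
          4 * (a * b) ℕ.≤ (a + b + d) * (a + b + d) ×
          (4 * (a * b) ≡ (a + b + d) * (a + b + d) → a ≡ b × d ≡ 0)
am-gm-≤ a k d = ≤-trans (m≤m+n _ _) (≤-reflexive (sym (am-gm-excess a k d))) , tight
  where
    tight : _ → _
    tight eq = sym (trans (cong (_+_ a) k≡0) (+-identityʳ a)) , d≡0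
      where
        -- Cancelling 4ab leaves an excess equal to 0; being a sum of naturals, it has both summands
        -- `k * k` and the multiple of `d` equal to 0.
        excess≡0 = +-cancelˡ-≡ (4 * (a * (a + k))) _ 0
          (trans (sym (am-gm-excess a k d)) (trans (sym eq) (sym (+-identityʳ _))))
        k≡0 : k ≡ 0
        k≡0 with m*n≡0⇒m≡0∨n≡0 k (m+n≡0⇒m≡0 (k * k) excess≡0)
        ... | inj₁ e = e
        ... | inj₂ e = e
        d≡0 : d ≡ 0
        d≡0 with m*n≡0⇒m≡0∨n≡0 d (m+n≡0⇒n≡0 (k * k) excess≡0)
        ... | inj₁ e = e
        -- The second factor contains `d` as a summand, so its vanishing also gives `d ≡ 0`.
        ... | inj₂ e = m+n≡0⇒n≡0 (a + (a + k) + (a + (a + k))) e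

-- Keeping the slack `d` inside the square lets a single equality case yield both `a ≡ b` and
-- `d ≡ 0`. The claim is symmetric in `a` and `b`, so the smaller one can be taken as base.
am-gm : ∀ a b d → 4 * (a * b) ℕ.≤ (a + b + d) * (a + b + d) ×
        (4 * (a * b) ≡ (a + b + d) * (a + b + d) → a ≡ b × d ≡ 0)
am-gm a b d with ≤-total a b
... | inj₁ a≤b with k , refl ← m≤n⇒∃[o]m+o≡n a≤b = am-gm-≤ a k d
am-gm a b d | inj₂ b≤a with k , refl ← m≤n⇒∃[o]m+o≡n b≤a
  rewrite *-comm (b + k) b | +-comm (b + k) b
  with bound , tight ← am-gm-≤ b k d = bound , λ eq → sym (proj₁ (tight eq)) , proj₂ (tight eq)

am-gm-≡ : ∀ {a b d} → a ≡ b → d ≡ 0 → 4 * (a * b) ≡ (a + b + d) * (a + b + d)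
am-gm-≡ {a} refl refl = eq a
  where
    eq : ∀ a → 4 * (a * a) ≡ (a + a + 0) * (a + a + 0)
    eq = solve-∀

-- The bounds make both truncated differences genuine: with `x = p + s` and `q = p + s + t` they are
-- `s` and `t`, and a polynomial identity remains.
+-*-interchange-∸ : ∀ {p x q} → p ℕ.≤ x → x ℕ.≤ q →
                    x ^ 2 + p * q + (x ∸ p) * (q ∸ x) ≡ (p + q) * x
+-*-interchange-∸ {p} p≤x x≤q
  with s , refl ← m≤n⇒∃[o]m+o≡n p≤x
  with t , refl ← m≤n⇒∃[o]m+o≡n x≤q
  rewrite m+n∸m≡n p s | m+n∸m≡n (p + s) t | ^2-* (p + s) = eq p s t
  where
    eq : ∀ p s t → (p + s) * (p + s) + p * (p + s + t) + s * t ≡ (p + (p + s + t)) * (p + s)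
    eq = solve-∀

-- The difference of the two sides factors as (q - p)(qb - pa), so for `p < q` the balance means
-- `q * b ≡ p * a`. Adding `p * b` or `q * a` to this turns it into the two proportions.
two-point-balance : ∀ {p q a b} → p ℕ.< q →
                    p * p * a + q * q * b ≡ p * q * (a + b) ⇔
                    (b * (p + q) ≡ (a + b) * p × a * (p + q) ≡ (a + b) * q)
two-point-balance {p} {q} {a} {b} p<q = mk⇔ to from
  where
    crossed : q * b ≡ p * a → p * p * a + q * q * b ≡ p * q * (a + b)
    crossed qb≡pa = begin
      p * p * a + q * q * b     ≡⟨ cong₂ _+_ (*-assoc p p a) (*-assoc q q b) ⟩
      p * (p * a) + q * (q * b) ≡⟨ cong₂ (λ u v → p * u + q * v) (sym qb≡pa) qb≡pa ⟩
      p * (q * b) + q * (p * a) ≡⟨ eq p q a b ⟩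
      p * q * (a + b)           ∎
      where
        open ≡-Reasoning
        eq : ∀ p q a b → p * (q * b) + q * (p * a) ≡ p * q * (a + b)
        eq = solve-∀

    from : _ → _
    from (eq , _) = crossed (+-cancelˡ-≡ (p * b) _ _ (trans (lhs p q b) (trans eq (rhs p a b))))
      where
        lhs : ∀ p q b → p * b + q * b ≡ b * (p + q)
        lhs = solve-∀
        rhs : ∀ p a b → (a + b) * p ≡ p * b + p * a
        rhs = solve-∀

    to : _ → _
    to eq with k , refl ← m≤n⇒∃[o]m+o≡n p<q =
      trans (split-b p q b) (trans (cong (_+_ (p * b)) qb≡pa) (join-b p a b)) ,
      trans (split-a p q a) (trans (cong (_+_ (q * a)) (sym qb≡pa)) (join-a q a b))
      where
        -- Here `suc k` is q - p; the factorisation is written with its negative terms moved across,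
        -- and `suc k` can be cancelled because it is nonzero.
        identity : ∀ p k a b → let q = suc p + k in
                   p * q * (a + b) + suc k * (q * b) ≡ p * p * a + q * q * b + suc k * (p * a)
        identity = solve-∀
        qb≡pa : q * b ≡ p * a
        qb≡pa = *-cancelˡ-≡ _ _ (suc k) (+-cancelˡ-≡ (p * q * (a + b)) _ _
          (trans (identity p k a b) (cong (_+ suc k * (p * a)) eq)))
        split-b : ∀ p q b → b * (p + q) ≡ p * b + q * b
        split-b = solve-∀
        join-b : ∀ p a b → p * b + p * a ≡ (a + b) * p
        join-b = solve-∀
        split-a : ∀ p q a → a * (p + q) ≡ q * a + p * a
        split-a = solve-∀
        join-a : ∀ q a b → q * a + q * b ≡ (a + b) * q
        join-a = solve-∀

-- A Pólya-Szegő type inequality for values in an interval, with its equality case.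

module PólyaSzegő {A : Set} (xs : List A) (f : A → ℕ) (p q : ℕ)
                  (p≤f : ∀ x → p ℕ.≤ f x) (f≤q : ∀ x → f x ℕ.≤ q) where

  N S Q D : ℕ
  N = length xs
  S = ∑ xs f
  Q = ∑[ x ∈ xs ] (f x ^ 2)
  D = ∑[ x ∈ xs ] ((f x ∸ p) * (q ∸ f x))

  count : ℕ → ℕ
  count k = length (filter (λ x → f x ℕ.≟ k) xs)

  Extremal : Set
  Extremal = All (λ x → f x ≡ p ⊎ f x ≡ q) xs

  -- The proportions p/(p + q) and q/(p + q) with denominators cleared: the smaller value `p` takes
  -- the share of weight `q`, and conversely.
  Counts : Set
  Counts = count q * (p + q) ≡ N * p × count p * (p + q) ≡ N * q

  Q+pqN+D≡[p+q]S : Q + p * q * N + D ≡ (p + q) * S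
  Q+pqN+D≡[p+q]S = begin
    Q + p * q * N + D
      ≡⟨ cong (λ c → Q + c + D) (∑-const xs (p * q)) ⟨
    Q + ∑[ _ ∈ xs ] (p * q) + D
      ≡⟨ cong (_+ D) (∑-+ xs _ _) ⟨
    ∑[ x ∈ xs ] (f x ^ 2 + p * q) + D
      ≡⟨ ∑-+ xs _ _ ⟨
    ∑[ x ∈ xs ] (f x ^ 2 + p * q + (f x ∸ p) * (q ∸ f x))
      ≡⟨ ∑-cong xs (λ x → +-*-interchange-∸ (p≤f x) (f≤q x)) ⟩
    ∑[ x ∈ xs ] ((p + q) * f x)
      ≡⟨ ∑-*ˡ xs (p + q) f ⟩
    (p + q) * S ∎
    where open ≡-Reasoning

  inequality : 4 * (Q * (p * q * N)) ℕ.≤ (p + q) * S * ((p + q) * S)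
  -- Rewriting `(p + q) * S` as `Q + p * q * N + D` exposes the shape of `am-gm`, with `D` as the
  -- slack.
  inequality rewrite sym Q+pqN+D≡[p+q]S = proj₁ (am-gm Q (p * q * N) D)

  equality-balanced : 4 * (Q * (p * q * N)) ≡ (p + q) * S * ((p + q) * S) ⇔ (Q ≡ p * q * N × D ≡ 0)
  equality-balanced rewrite sym Q+pqN+D≡[p+q]S = 
    mk⇔ (proj₂ (am-gm Q (p * q * N) D)) λ (Q≡pqN , D≡0) → am-gm-≡ Q≡pqN D≡0

  -- A zero sum of naturals has zero terms, and a zero product has a zero factor. A vanishing
  -- truncated difference gives only one inequality; the interval bounds supply the other.
  D≡0⇒extremal : D ≡ 0 → Extremal
  D≡0⇒extremal D≡0 = All.map endpoint (∑-tight xs (λ _ → z≤n) (trans (∑-const xs 0) (sym D≡0)))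
    where
      endpoint : ∀ {x} → 0 ≡ (f x ∸ p) * (q ∸ f x) → f x ≡ p ⊎ f x ≡ q
      endpoint {x} eq with m*n≡0⇒m≡0∨n≡0 (f x ∸ p) (sym eq)
      ... | inj₁ e = inj₁ (≤-antisym (m∸n≡0⇒m≤n e) (p≤f x))
      ... | inj₂ e = inj₂ (≤-antisym (f≤q x) (m∸n≡0⇒m≤n e))

  extremal⇒D≡0 : Extremal → D ≡ 0
  extremal⇒D≡0 ext = trans (∑-cong-local xs (All.map vanish ext)) (∑-const xs 0)
    where
      vanish : ∀ {x} → f x ≡ p ⊎ f x ≡ q → (f x ∸ p) * (q ∸ f x) ≡ 0
      vanish (inj₁ refl) = cong (_* (q ∸ p)) (n∸n≡0 p)
      vanish {x} (inj₂ refl) = trans (cong ((f x ∸ p) *_) (n∸n≡0 (f x))) (*-zeroʳ (f x ∸ p))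

  constant⇒balanced : p ≡ q → Q ≡ p * q * N × D ≡ 0
  constant⇒balanced refl =
    trans (∑-cong xs λ x → trans (cong (_^ 2) (f≡p x)) (^2-* p)) (∑-const xs (p * p)) ,
    extremal⇒D≡0 (All.universal (λ x → inj₁ (f≡p x)) xs)
    where
      f≡p : ∀ x → f x ≡ p
      f≡p x = ≤-antisym (f≤q x) (p≤f x)

  module _ (p<q : p ℕ.< q) where

    private
      [p] [q] : A → ℕ
      [p] x = 𝟙 (f x ℕ.≟ p)
      [q] x = 𝟙 (f x ℕ.≟ q)

    count+count : count p + count q ≡ ∑[ x ∈ xs ] ([p] x + [q] x)
    count+count = trans (cong₂ _+_ (length-filter-∑ _ xs) (length-filter-∑ _ xs)) (sym (∑-+ xs [p] [q]))

    N≡∑1 : N ≡ ∑[ _ ∈ xs ] 1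
    N≡∑1 = sym (trans (∑-const xs 1) (*-identityˡ N))

    at-p : ∀ {x} → f x ≡ p → [p] x ≡ 1 × [q] x ≡ 0
    at-p {x} e = 𝟙-yes (f x ℕ.≟ p) e , 𝟙-no (f x ℕ.≟ q) λ e′ → <⇒≢ p<q (trans (sym e) e′)

    at-q : ∀ {x} → f x ≡ q → [p] x ≡ 0 × [q] x ≡ 1
    at-q {x} e = 𝟙-no (f x ℕ.≟ p) (λ e′ → <⇒≢ p<q (trans (sym e′) e)) , 𝟙-yes (f x ℕ.≟ q) e

    extremal⇒𝟙 : ∀ {x} → f x ≡ p ⊎ f x ≡ q → [p] x + [q] x ≡ 1
    extremal⇒𝟙 (inj₁ e) = cong₂ _+_ (proj₁ (at-p e)) (proj₂ (at-p e))
    extremal⇒𝟙 (inj₂ e) = cong₂ _+_ (proj₁ (at-q e)) (proj₂ (at-q e))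

    -- Away from both endpoints the two indicators vanish. With the value 1 at an endpoint, this
    -- yields both the bound by 1 and the fact that 1 is attained only at endpoints.
    extremal? : ∀ x → (f x ≡ p ⊎ f x ≡ q) ⊎ [p] x + [q] x ≡ 0
    extremal? x with f x ℕ.≟ p | f x ℕ.≟ q
    ... | yes e | _     = inj₁ (inj₁ e)
    ... | no _  | yes e = inj₁ (inj₂ e)
    ... | no ¬p | no ¬q = inj₂ (cong₂ _+_ (𝟙-no (f x ℕ.≟ p) ¬p) (𝟙-no (f x ℕ.≟ q) ¬q))

    𝟙≤1 : ∀ x → [p] x + [q] x ℕ.≤ 1
    𝟙≤1 x with extremal? x
    ... | inj₁ ext = ≤-reflexive (extremal⇒𝟙 ext)
    ... | inj₂ ≡0  = ≤-trans (≤-reflexive ≡0) z≤n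

    𝟙⇒extremal : ∀ {x} → [p] x + [q] x ≡ 1 → f x ≡ p ⊎ f x ≡ q
    𝟙⇒extremal {x} ≡1 with extremal? x
    ... | inj₁ ext = ext
    ... | inj₂ ≡0  = contradiction (trans (sym ≡0) ≡1) 0≢1+n

    extremal⇒count : Extremal → count p + count q ≡ N
    extremal⇒count ext = trans count+count
      (trans (∑-cong-local xs (All.map extremal⇒𝟙 ext)) (sym N≡∑1))

    -- Each entry contributes at most 1 to the two counts together, so a total of `N` forces every
    -- entry to contribute exactly 1.
    count⇒extremal : count p + count q ≡ N → Extremal
    count⇒extremal eq = All.map 𝟙⇒extremal
      (∑-tight xs 𝟙≤1 (trans (sym count+count) (trans eq N≡∑1)))

    extremal⇒Q : Extremal → Q ≡ p * p * count p + q * q * count q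
    extremal⇒Q ext = begin
      Q
        ≡⟨ ∑-cong-local xs (All.map square ext) ⟩
      ∑[ x ∈ xs ] (p * p * [p] x + q * q * [q] x)
        ≡⟨ ∑-+ xs _ _ ⟩
      ∑[ x ∈ xs ] (p * p * [p] x) + ∑[ x ∈ xs ] (q * q * [q] x)
        ≡⟨ cong₂ _+_ (∑-*ˡ xs (p * p) [p]) (∑-*ˡ xs (q * q) [q]) ⟩
      p * p * ∑ xs [p] + q * q * ∑ xs [q]
        ≡⟨ cong₂ (λ a b → p * p * a + q * q * b) (length-filter-∑ _ xs) (length-filter-∑ _ xs) ⟨
      p * p * count p + q * q * count q ∎
      where
        open ≡-Reasoning
        square : ∀ {x} → f x ≡ p ⊎ f x ≡ q → f x ^ 2 ≡ p * p * [p] x + q * q * [q] x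
        square (inj₁ e) rewrite proj₁ (at-p e) | proj₂ (at-p e) | e | ^2-* p = eq (p * p) (q * q)
          where
            eq : ∀ a b → a ≡ a * 1 + b * 0
            eq = solve-∀
        square (inj₂ e) rewrite proj₁ (at-q e) | proj₂ (at-q e) | e | ^2-* q = eq (p * p) (q * q)
          where
            eq : ∀ a b → b ≡ a * 0 + b * 1
            eq = solve-∀

    -- On an extremal list both `Q` and `N` are expressed through the two counts, and
    -- `Q ≡ p * q * N` becomes the hypothesis of `two-point-balance`. Extremality comes from `D ≡ 0`
    -- in one direction and from the counts adding up to `N` in the other.
    balanced⇔counts : (Q ≡ p * q * N × D ≡ 0) ⇔ Counts
    balanced⇔counts = mk⇔ to from
      where
        to : Q ≡ p * q * N × D ≡ 0 → Counts
        to (Q≡pqN , D≡0) =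
          subst (λ n → count q * (p + q) ≡ n * p × count p * (p + q) ≡ n * q) count≡N
            (Equivalence.to (two-point-balance p<q)
              (trans (sym (extremal⇒Q ext)) (trans Q≡pqN (cong (p * q *_) (sym count≡N)))))
          where
            ext = D≡0⇒extremal D≡0
            count≡N = extremal⇒count ext

        from : Counts → Q ≡ p * q * N × D ≡ 0
        from counts@(cq , cp) =
          trans (extremal⇒Q ext)
            (trans (Equivalence.from (two-point-balance p<q)
                     (subst (λ n → count q * (p + q) ≡ n * p × count p * (p + q) ≡ n * q)
                       (sym count≡N) counts))
                   (cong (p * q *_) count≡N)) ,
          extremal⇒D≡0 ext
          where
            instance p+q≢0 = ℕ.>-nonZero (≤-trans (≤-trans (s≤s z≤n) p<q) (m≤n+m q p))
            -- Adding the two proportions gives both sides a factor `p + q`, which is positive since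
            -- `p < q`.
            count≡N : count p + count q ≡ N
            count≡N = *-cancelʳ-≡ _ _ (p + q) (begin
              (count p + count q) * (p + q)           ≡⟨ *-distribʳ-+ (p + q) (count p) (count q) ⟩
              count p * (p + q) + count q * (p + q)   ≡⟨ cong₂ _+_ cp cq ⟩
              N * q + N * p                           ≡⟨ *-distribˡ-+ N q p ⟨
              N * (q + p)                             ≡⟨ cong (N *_) (+-comm q p) ⟩
              N * (p + q)                             ∎)
              where open ≡-Reasoning
            ext = count⇒extremal count≡N

  -- Distinct endpoints reduce to the counts; coinciding endpoints make the list constant, and a
  -- constant list is balanced.
  equality : p ℕ.≤ q → 4 * (Q * (p * q * N)) ≡ (p + q) * S * ((p + q) * S) ⇔ (p ≡ q ⊎ Counts)
  equality p≤q = mk⇔ (to ∘ Equivalence.to equality-balanced) (Equivalence.from equality-balanced ∘ from)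
    where
      to : Q ≡ p * q * N × D ≡ 0 → p ≡ q ⊎ Counts
      to balanced with m≤n⇒m<n∨m≡n p≤q
      ... | inj₁ p<q = inj₂ (Equivalence.to (balanced⇔counts p<q) balanced)
      ... | inj₂ p≡q = inj₁ p≡q
      from : p ≡ q ⊎ Counts → Q ≡ p * q * N × D ≡ 0
      from (inj₁ p≡q) = constant⇒balanced p≡q
      from (inj₂ counts) with m≤n⇒m<n∨m≡n p≤q
      ... | inj₁ p<q = Equivalence.from (balanced⇔counts p<q) counts
      ... | inj₂ p≡q = constant⇒balanced p≡q

-- Application to edge degrees of a graph.

module _ {n : ℕ} (G : Graph n) where
  open Graph G

  private
    V : List (Fin.Fin n)
    V = allFin n

    edge? : ∀ u v → Dec (u Fin.< v × Adj u v)
    edge? u v = (u Fin.<? v) ×-dec adj? u v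

  -- An adjacent pair is listed in exactly one of its two orders, by trichotomy; on the diagonal
  -- irreflexivity makes everything 0.
  edge?-orient : ∀ u v → 𝟙 (edge? u v) + 𝟙 (edge? v u) ≡ 𝟙 (adj? u v)
  edge?-orient u v with Fin.<-cmp u v
  ... | tri< u<v _ v≮u = trans
    (cong₂ _+_ (𝟙-cong (edge? u v) (adj? u v) proj₂ (u<v ,_)) (𝟙-no (edge? v u) (v≮u ∘ proj₁)))
    (+-identityʳ _)
  ... | tri≈ u≮v u≡v v≮u = trans
    (cong₂ _+_ (𝟙-no (edge? u v) (u≮v ∘ proj₁)) (𝟙-no (edge? v u) (v≮u ∘ proj₁)))
    (sym (𝟙-no (adj? u v) (irrefl u≡v)))
  ... | tri> u≮v _ v<u =
    cong₂ _+_ (𝟙-no (edge? u v) (u≮v ∘ proj₁))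
              (𝟙-cong (edge? v u) (adj? u v) (symm ∘ proj₂) (λ uv → v<u , symm uv))

  -- Double counting: a vertex contributes its degree once for each incident edge, hence its degree
  -- squared in total.
  ∑edgeDegree≡M₁ : ∑ edges edgeDegree ≡ M₁
  ∑edgeDegree≡M₁ = begin
    ∑ edges edgeDegree
      ≡⟨ ∑-filter (λ (u , v) → edge? u v) (cartesianProduct V V) edgeDegree ⟩
    ∑ (cartesianProduct V V) (λ (u , v) → 𝟙 (edge? u v) * (degree u + degree v))
      ≡⟨ ∑-cartesianProduct V V _ ⟩
    ∑[ u ∈ V ] (∑[ v ∈ V ] (𝟙 (edge? u v) * (degree u + degree v)))
      ≡⟨ ∑-cong V (λ u → trans
           (∑-cong V (λ v → *-distribˡ-+ (𝟙 (edge? u v)) (degree u) (degree v)))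
           (∑-+ V (λ v → 𝟙 (edge? u v) * degree u) (λ v → 𝟙 (edge? u v) * degree v))) ⟩
    ∑[ u ∈ V ] (∑[ v ∈ V ] (𝟙 (edge? u v) * degree u) + ∑[ v ∈ V ] (𝟙 (edge? u v) * degree v))
      ≡⟨ ∑-+ V _ _ ⟩
    ∑[ u ∈ V ] (∑[ v ∈ V ] (𝟙 (edge? u v) * degree u)) +
    ∑[ u ∈ V ] (∑[ v ∈ V ] (𝟙 (edge? u v) * degree v))
      -- Exchanging the sums turns the share of the larger endpoint into a term in `degree u` over
      -- edges listed as `(v , u)`, so that both orientations meet at the same `u`.
      ≡⟨ cong (_+_ _) (∑-swap V V (λ u v → 𝟙 (edge? u v) * degree v)) ⟩
    ∑[ u ∈ V ] (∑[ v ∈ V ] (𝟙 (edge? u v) * degree u)) +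
    ∑[ u ∈ V ] (∑[ v ∈ V ] (𝟙 (edge? v u) * degree u))
      ≡⟨ ∑-+ V _ _ ⟨
    ∑[ u ∈ V ] (∑[ v ∈ V ] (𝟙 (edge? u v) * degree u) + ∑[ v ∈ V ] (𝟙 (edge? v u) * degree u))
      ≡⟨ ∑-cong V degree-square ⟩
    M₁ ∎
    where
      open ≡-Reasoning
      degree-square : ∀ u → ∑[ v ∈ V ] (𝟙 (edge? u v) * degree u) + ∑[ v ∈ V ] (𝟙 (edge? v u) * degree u)
                            ≡ degree u ^ 2
      degree-square u = begin
        ∑[ v ∈ V ] (𝟙 (edge? u v) * degree u) + ∑[ v ∈ V ] (𝟙 (edge? v u) * degree u)
          ≡⟨ ∑-+ V _ _ ⟨
        ∑[ v ∈ V ] (𝟙 (edge? u v) * degree u + 𝟙 (edge? v u) * degree u)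
          ≡⟨ ∑-cong V (λ v → trans (sym (*-distribʳ-+ (degree u) (𝟙 (edge? u v)) (𝟙 (edge? v u))))
               (trans (cong (_* degree u) (edge?-orient u v)) (*-comm _ (degree u)))) ⟩
        ∑[ v ∈ V ] (degree u * 𝟙 (adj? u v))
          ≡⟨ ∑-*ˡ V (degree u) (λ v → 𝟙 (adj? u v)) ⟩
        degree u * ∑[ v ∈ V ] 𝟙 (adj? u v)
          ≡⟨ cong (degree u *_) (length-filter-∑ (adj? u) V) ⟨
        degree u * degree u
          ≡⟨ ^2-* (degree u) ⟨
        degree u ^ 2 ∎

  δ≤degree : ∀ u → δ ℕ.≤ degree u
  δ≤degree u = All.lookup (min≤xs Δ degrees) (∈-map⁺ degree (∈-allFin u))

  degree≤Δ : ∀ u → degree u ℕ.≤ Δ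
  degree≤Δ u = All.lookup (xs≤max 0 degrees) (∈-map⁺ degree (∈-allFin u))

  δ≤Δ : δ ℕ.≤ Δ
  δ≤Δ = min≤⊤ Δ degrees

  δ≡Δ⇔regular : δ ≡ Δ ⇔ Regular
  δ≡Δ⇔regular = mk⇔ to from
    where
      to : δ ≡ Δ → Regular
      to δ≡Δ u v = trans (constant u) (sym (constant v))
        where
          constant : ∀ u → degree u ≡ δ
          constant u = ≤-antisym (≤-trans (degree≤Δ u) (≤-reflexive (sym δ≡Δ))) (δ≤degree u)
      from : Regular → δ ≡ Δ
      -- `≤-refl` covers the default `Δ` of the minimum; below, `z≤n` covers the default 0 of the
      -- maximum.
      from reg = ≤-antisym δ≤Δ (v≤min⁺ ≤-refl (All.map⁺ (All.universal Δ≤ V)))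
        where
          Δ≤ : ∀ u → Δ ℕ.≤ degree u
          Δ≤ u = max≤v⁺ z≤n (All.map⁺ (All.universal (λ v → ≤-reflexive (reg v u)) V))

  -- An edge has two ends, hence the interval from `2 * δ` to `2 * Δ`. `N` and `Q` are `m` and `HM₁`
  -- by definition, whereas `S` is `M₁` only through double counting.
  open PólyaSzegő edges edgeDegree (2 * δ) (2 * Δ)
    (λ (u , v) → ≤-trans (≤-reflexive (2*-+ δ)) (+-mono-≤ (δ≤degree u) (δ≤degree v)))
    (λ (u , v) → ≤-trans (+-mono-≤ (degree≤Δ u) (degree≤Δ v)) (≤-reflexive (sym (2*-+ Δ))))
    using (inequality; equality; Counts)

  private
    lhs : 4 * (HM₁ * (2 * δ * (2 * Δ) * m)) ≡ 4 * (HM₁ * (4 * m * Δ * δ))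
    lhs = eq HM₁ δ Δ m
      where
        eq : ∀ h d D m → 4 * (h * (2 * d * (2 * D) * m)) ≡ 4 * (h * (4 * m * D * d))
        eq = solve-∀

    rhs : (2 * δ + 2 * Δ) * ∑ edges edgeDegree * ((2 * δ + 2 * Δ) * ∑ edges edgeDegree) ≡
          4 * ((Δ + δ) ^ 2 * M₁ ^ 2)
    rhs rewrite ∑edgeDegree≡M₁ | ^2-* (Δ + δ) | ^2-* M₁ = eq δ Δ M₁
      where
        eq : ∀ d D m → (2 * d + 2 * D) * m * ((2 * d + 2 * D) * m) ≡ 4 * ((D + d) * (D + d) * (m * m))
        eq = solve-∀

  HM₁-bound : HM₁ * (4 * m * Δ * δ) ℕ.≤ (Δ + δ) ^ 2 * M₁ ^ 2
  -- The cancelled 4 comes from AM-GM on the left and from squaring the doubled endpoints on the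
  -- right.
  HM₁-bound = *-cancelˡ-≤ 4 (subst₂ ℕ._≤_ lhs rhs inequality)

  HM₁-equality : HM₁ * (4 * m * Δ * δ) ≡ (Δ + δ) ^ 2 * M₁ ^ 2 ⇔ (Regular ⊎ Counts)
  HM₁-equality = (halve ⊎-⇔ ⇔-id _) ⇔-∘ (equality (*-monoʳ-≤ 2 δ≤Δ) ⇔-∘ quadruple)
    where
      quadruple = mk⇔ (λ eq → trans lhs (trans (cong (4 *_) eq) (sym rhs)))
                      (λ eq → *-cancelˡ-≡ _ _ 4 (trans (sym lhs) (trans eq rhs)))
      halve : 2 * δ ≡ 2 * Δ ⇔ Regular
      halve = δ≡Δ⇔regular ⇔-∘ mk⇔ (*-cancelˡ-≡ δ Δ 2) (cong (2 *_))

  -- After a factor 2 is cancelled, the proportions read `m * δ ≡ c * (Δ + δ)` and likewise for `Δ`.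
  -- Division rounds down, so divisibility is what lets the quotients be multiplied back.
  counts⇔quotients : .⦃ _ : NonZero (Δ + δ) ⦄ → Counts ⇔
    ( edgesOfDegree (2 * Δ) ≡ (m * δ) ℕ./ (Δ + δ)
    × edgesOfDegree (2 * δ) ≡ (m * Δ) ℕ./ (Δ + δ)
    × (Δ + δ) ∣ (m * δ))
  counts⇔quotients = mk⇔ to from
    where
      double : ∀ c e → c * (2 * δ + 2 * Δ) ≡ m * (2 * e) ⇔ m * e ≡ c * (Δ + δ)
      double c e = mk⇔
        (λ eq → *-cancelˡ-≡ _ _ 2 (trans (r m e) (trans (sym eq) (l c δ Δ))))
        (λ eq → trans (l c δ Δ) (trans (cong (2 *_) (sym eq)) (r m e)))
        where
          l : ∀ c d D → c * (2 * d + 2 * D) ≡ 2 * (c * (D + d))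
          l = solve-∀
          r : ∀ m e → 2 * (m * e) ≡ m * (2 * e)
          r = solve-∀

      exact : ∀ {a b} c → a ≡ c * b → .⦃ _ : NonZero b ⦄ → c ≡ a ℕ./ b
      exact {b = b} c refl = sym (m*n/n≡m c b)

      to : Counts → _
      to (cΔ , cδ) = exact _ mδ , exact _ mΔ , divides (edgesOfDegree (2 * Δ)) mδ
        where
          mδ = Equivalence.to (double (edgesOfDegree (2 * Δ)) δ) cΔ
          mΔ = Equivalence.to (double (edgesOfDegree (2 * δ)) Δ) cδ

      from : _ → Counts
      from (cΔ , cδ , ∣mδ) =
        Equivalence.from (double (edgesOfDegree (2 * Δ)) δ) (trans (sym (m/n*n≡m ∣mδ)) (cong (_* (Δ + δ)) (sym cΔ))) ,
        Equivalence.from (double (edgesOfDegree (2 * δ)) Δ) (trans (sym (m/n*n≡m ∣mΔ)) (cong (_* (Δ + δ)) (sym cδ)))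
        where
          ∣mΔ : (Δ + δ) ∣ (m * Δ)
          -- `Δ + δ` divides `m * (Δ + δ)`, the sum of `m * δ` and `m * Δ`, so it divides the second
          -- summand along with the first.
          ∣mΔ = ∣m+n∣m⇒∣n (subst ((Δ + δ) ∣_)
                  (trans (*-distribˡ-+ m Δ δ) (+-comm (m * Δ) (m * δ))) (n∣m*n m)) ∣mδ

-- Transfer of cross-multiplied statements to the rationals.

toℚᵘ-/1 : ∀ a → toℚᵘ (+ a ℚ./ 1) ℚᵘ.≃ mkℚᵘ (+ a) 0
toℚᵘ-/1 a = ℚ.toℚᵘ-fromℚᵘ (mkℚᵘ (+ a) 0)

-- Normalised rationals reduce their fractions and hide the given numerators; unnormalised ones keep
-- them. The denominator is `suc d-1` because `mkℚᵘ` stores it minus one.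
toℚᵘ-/-* : ∀ b c d-1 → toℚᵘ ((+ b ℚ./ suc d-1) ℚ.* (+ c ℚ./ 1)) ℚᵘ.≃ mkℚᵘ (+ (b * c)) d-1
toℚᵘ-/-* b c d-1 = begin
  toℚᵘ ((+ b ℚ./ suc d-1) ℚ.* (+ c ℚ./ 1))
    ≈⟨ ℚ.toℚᵘ-homo-* (+ b ℚ./ suc d-1) (+ c ℚ./ 1) ⟩
  toℚᵘ (+ b ℚ./ suc d-1) ℚᵘ.* toℚᵘ (+ c ℚ./ 1)
    ≈⟨ ℚᵘ.*-cong (ℚ.toℚᵘ-fromℚᵘ (mkℚᵘ (+ b) d-1)) (toℚᵘ-/1 c) ⟩
  mkℚᵘ (+ b) d-1 ℚᵘ.* mkℚᵘ (+ c) 0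
    ≈⟨ *≡* (cong₂ ℤ._*_ (sym (ℤ.pos-* b c)) (cong +_ (sym (*-identityʳ (suc d-1))))) ⟩
  mkℚᵘ (+ (b * c)) d-1 ∎
  where open import Relation.Binary.Reasoning.Setoid ℚᵘ.≃-setoid

-- On unnormalised fractions the order is cross-multiplication by definition, so only casts from
-- naturals to integers and a factor 1 have to be cleared.
cross-multiply-≤ : ∀ a b c d .⦃ _ : NonZero d ⦄ → a * d ℕ.≤ b * c →
                   + a ℚ./ 1 ℚ.≤ (+ b ℚ./ d) ℚ.* (+ c ℚ./ 1)
cross-multiply-≤ a b c (suc d-1) ad≤bc = ℚ.toℚᵘ-cancel-≤
  (ℚᵘ.≤-respˡ-≃ (ℚᵘ.≃-sym (toℚᵘ-/1 a)) (ℚᵘ.≤-respʳ-≃ (ℚᵘ.≃-sym (toℚᵘ-/-* b c d-1))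
    (*≤* (subst₂ ℤ._≤_ (ℤ.pos-* a (suc d-1)) (sym (ℤ.*-identityʳ (+ (b * c)))) (ℤ.+≤+ ad≤bc)))))

cross-multiply-≡ : ∀ a b c d .⦃ _ : NonZero d ⦄ →
                   + a ℚ./ 1 ≡ (+ b ℚ./ d) ℚ.* (+ c ℚ./ 1) ⇔ a * d ≡ b * c
cross-multiply-≡ a b c (suc d-1) = mk⇔ to from
  where
    to : _ → _
    to eq with *≡* e ← ℚᵘ.≃-trans (ℚᵘ.≃-sym (toℚᵘ-/1 a))
                         (ℚᵘ.≃-trans (ℚ.toℚᵘ-cong eq) (toℚᵘ-/-* b c d-1)) =
      ℤ.+-injective (trans (ℤ.pos-* a (suc d-1)) (trans e (ℤ.*-identityʳ (+ (b * c)))))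

    from : _ → _
    from eq = ℚ.toℚᵘ-injective (ℚᵘ.≃-trans (toℚᵘ-/1 a) (ℚᵘ.≃-trans
      (*≡* (trans (sym (ℤ.pos-* a (suc d-1))) (trans (cong +_ eq) (sym (ℤ.*-identityʳ (+ (b * c)))))))
      (ℚᵘ.≃-sym (toℚᵘ-/-* b c d-1))))

theorem4 : ∀ {n : ℕ} (G : Graph n) → let open Graph G in
  (2≤δ : 2 ℕ.≤ δ) →
  let instance
        4mΔδ-nonZero = 4mΔδ≢0 2≤δ
        Δ+δ-nonZero  = Δ+δ≢0 2≤δ
      hm    = + HM₁ ℚ./ 1
      bound = (+ ((Δ + δ) ^ 2) ℚ./ (4 * m * Δ * δ)) ℚ.* (+ (M₁ ^ 2) ℚ./ 1)
  in
    (hm ℚ.≤ bound)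
    × (hm ≡ bound ⇔
        ( Regular
        ⊎ ( (edgesOfDegree (2 * Δ) ≡ (m * δ) ℕ./ (Δ + δ))
          × (edgesOfDegree (2 * δ) ≡ (m * Δ) ℕ./ (Δ + δ))
          × (Δ + δ) ∣ (m * δ))))
theorem4 G 2≤δ =
  cross-multiply-≤ HM₁ ((Δ + δ) ^ 2) (M₁ ^ 2) (4 * m * Δ * δ) (HM₁-bound G) ,
  ((⇔-id _ ⊎-⇔ counts⇔quotients G) ⇔-∘ (HM₁-equality G ⇔-∘
    cross-multiply-≡ HM₁ ((Δ + δ) ^ 2) (M₁ ^ 2) (4 * m * Δ * δ)))
  where
    open Graph G
    instance
      4mΔδ-nonZero = 4mΔδ≢0 2≤δ
      Δ+δ-nonZero  = Δ+δ≢0 2≤δ
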